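{- Let $N=(B,E,F)$ be a locally finite, K-dense causal net, and let $L(N)$ be its lattice of closed sets. (a) Let $\tau=\{b_1,\ldots,b_i,\ldots\}$ be a B-cut of $N$, and for each $b_i\in\tau$ let $\beta_i=\{b_i\}''$. Then the closed sets $\beta_i$ are pairwise orthogonal in $L(N)$ (that is, pairwise concurrent in $N$), their join in $L(N)$ is $B\cup E$, and $\{\beta_1,\ldots,\beta_i,\ldots\}$ is the set of atoms of a (maximal) Boolean subalgebra of $L(N)$. (b) More generally, given a family $(A_i)_{i\in I}$ of pairwise orthogonal (concurrent) closed sets such that $\bigvee_{i\in I}A_i=B\cup E$, there is a Boolean subalgebra of $L(N)$ such that the $A_i$, $i\in I$, are its atoms.
   Context: A net is a triple $N=(B,E,F)$ where $B$ (conditions) and $E$ (events) are countable disjoint sets, $F\subseteq (B\times E)\cup(E\times B)$, and $\mathrm{dom}(F)\cup\mathrm{ran}(F)=B\cup E$. For $x\in B\cup E$ put ${}^\bullet x=\{y : (y,x)\in F\}$ and $x^\bullet=\{y : (x,y)\in F\}$. Let $F^+$ be the transitive closure of $F$ and $F^*$ its reflexive-transitive closure. $N$ is a causal net if every $b\in B$ satisfies $|{}^\bullet b|\le 1$ and $|b^\bullet|\le 1$, and for all $x,y\in B\cup E$, $(x,y)\in F^+$ implies $(y,x)\notin F^+$. Put $X=B\cup E$ and $\sqsubseteq\,=F^*$; then $(X,\sqsubseteq)$ is a partially ordered set. $N$ is locally finite if every interval $[x,y]=\{z : x\sqsubseteq z\sqsubseteq y\}$ is finite and, for all $x\in X$,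 ${}^\bullet x$ and $x^\bullet$ are finite. Define $\mathbf{li}=\,\sqsubseteq\cup\sqsubseteq^{ -1}$ (comparability) and $\mathbf{co}=(X\times X)\setminus\mathbf{li}$ (concurrency). Two subsets of $X$ are concurrent if every element of one is $\mathbf{co}$-related to every element of the other. A line is a maximal set of pairwise $\mathbf{li}$-related elements (maximal chain); a cut is a maximal set of pairwise $\mathbf{co}\cup\mathrm{id}_X$-related elements (maximal antichain). A B-cut is a cut consisting only of conditions. $N$ is K-dense if every cut and every line of $(X,\sqsubseteq)$ have non-empty intersection. For $A\subseteq X$ let $A'=\{x\in X : \forall y\in A,\ x\ \mathbf{co}\ y\}$. $A$ is closed if $A=A''$, and $L(N)$ is the family of closed subsets of $X$. Ordered by inclusion, with orthocomplementation $A\mapsto A'$, minimum $\emptyset$ and maximum $X$, $L(N)$ is a complete orthocomplemented lattice (in fact orthomodular: $A\subseteq C$ implies $C=A\vee(C\wedge A')$), in which the meet is intersection and the join of a family $(A_i)$ is $(\bigcup_i A_i)''$. Closed sets $A,C$ are orthogonal if $A\subseteq C'$. A Boolean subalgebra of $L(N)$ is a subset of $L(N)$ containing $\emptyset$ and $X$, closed under $(\cdot)'$ and under binary meet and join of $L(N)$, which is a Boolean algebra with these operations; it is maximal if it is not properly contained in another Boolean subalgebra of $L(N)$.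
   Formalization: In (a) "maximal" means maximal among Boolean subalgebras in which all β_i are atoms, and maximal in L(N) if the β_i are atoms of L(N) (false in general: b→e→{b1,b2}, τ={b}); in (b) the atoms are exactly the non-empty A_i, since an empty A_i cannot be an atom. -}

module Defs where

open import Algebra.Lattice.Structures using (IsBooleanAlgebra)
open import Axiom.ExcludedMiddle using (ExcludedMiddle)
open import Data.List.Base using (List)
open import Data.List.Membership.Propositional using () renaming (_∈_ to _∈ₗ_)
open import Data.Nat.Base using (ℕ)
open import Data.Product using (Σ; ∃; _×_; _,_; proj₁; proj₂)
open import Data.Sum.Base using (_⊎_; inj₁; inj₂; swap)
open import Data.Unit.Base using (tt) renaming (⊤ to Unit)
open import Function.Base using (_∘_)
open import Function.Bundles using (_↣_; _⇔_)
open import Level using (0ℓ; suc; _⊔_; Setω)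
open import Relation.Binary.Construct.Closure.ReflexiveTransitive using (Star; ε)
open import Relation.Binary.Construct.Closure.Transitive using (TransClosure)
open import Relation.Binary.Core using (Rel)
open import Relation.Binary.Definitions using (_Respects_)
open import Relation.Binary.PropositionalEquality.Core using (_≡_)
open import Relation.Nullary.Negation.Core using (¬_)
open import Relation.Unary using (Pred; _∈_; _⊆_; _≐_; _∩_; _∪_; U; ∅; ⋃; Satisfiable; ｛_｝)

-- The paper argues classically.  Under excluded middle at every level a
-- `Pred A 0ℓ` is as general as a predicate on A of any other level, so
-- below "subset of A" always means `Pred A 0ℓ`.
Classical : Setω
Classical = ∀ {ℓ} → ExcludedMiddle ℓ

Subset : ∀ {a} → Set a → Set (a ⊔ suc 0ℓ)
Subset A = Pred A 0ℓ

-- Elements of the subset are counted, not proofs of membership.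
Finite : {A : Set} → Subset A → Set
Finite {A} P = Σ (List A) λ xs → P ⊆ (_∈ₗ xs)

Maximal : ∀ {a r p} {A : Set a} → Rel A r → Pred A p → Pred A (a ⊔ r ⊔ p)
Maximal _≤_ P a = P a × (∀ b → P b → a ≤ b → b ≤ a)

IsCondition IsEvent : {B E : Set} → Subset (B ⊎ E)
IsCondition x = ∃ λ b → x ≡ inj₁ b
IsEvent     x = ∃ λ e → x ≡ inj₂ e

-- B ∪ E is the disjoint sum B ⊎ E.
record Net : Set₁ where
  field
    B E       : Set
    F         : Rel (B ⊎ E) 0ℓ
    countB    : B ↣ ℕ
    countE    : E ↣ ℕ

  X : Set
  X = B ⊎ E

  field
    bipartite : ∀ {x y} → F x y →
                (IsCondition x × IsEvent y) ⊎ (IsEvent x × IsCondition y)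
    dom∪ran   : ∀ x → (∃ λ y → F x y) ⊎ (∃ λ y → F y x)

module NetTheory (N : Net) where

  open Net N public

  infix 4 _⊑_ _li_ _co_
  infix 8 _•
  infix 9 •_
  infix 8 _′

  •_ : X → Subset X
  (• x) y = F y x

  _• : X → Subset X
  (x •) y = F x y

  _⊑_ : Rel X 0ℓ
  _⊑_ = Star F

  AtMostOne : Subset X → Set
  AtMostOne P = ∀ x y → P x → P y → x ≡ y

  record IsCausal : Set where
    field
      pre≤1   : ∀ b → AtMostOne (• (inj₁ b))
      post≤1  : ∀ b → AtMostOne (inj₁ b •)
      acyclic : ∀ x y → TransClosure F x y → ¬ TransClosure F y x

  record IsLocallyFinite : Set where
    field
      intervals : ∀ x y → Finite (λ z → x ⊑ z × z ⊑ y)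
      pre       : ∀ x → Finite (• x)
      post      : ∀ x → Finite (x •)

  _li_ _co_ : Rel X 0ℓ
  x li y = x ⊑ y ⊎ y ⊑ x
  x co y = ¬ (x li y)

  IsLine IsCut IsBCut : Pred (Subset X) (suc 0ℓ)
  IsLine = Maximal _⊆_ λ ℓ → ∀ x y → x ∈ ℓ → y ∈ ℓ → x li y
  IsCut  = Maximal _⊆_ λ τ → ∀ x y → x ∈ τ → y ∈ τ → x co y ⊎ x ≡ y
  IsBCut τ = IsCut τ × τ ⊆ IsCondition

  IsKDense : Set₁
  IsKDense = ∀ τ ℓ → IsCut τ → IsLine ℓ → Satisfiable (τ ∩ ℓ)

  _′ : Subset X → Subset X
  (A ′) x = ∀ y → y ∈ A → x co y

  A⊆A″ : ∀ A → A ⊆ A ′ ′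
  A⊆A″ A x∈A y y∈A′ = y∈A′ _ x∈A ∘ swap

  ′-anti : ∀ {A C} → A ⊆ C → C ′ ⊆ A ′
  ′-anti A⊆C x∈C′ y y∈A = x∈C′ y (A⊆C y∈A)

  record ClosedSet : Set₁ where
    constructor mk
    field
      set    : Subset X
      closed : set ≐ set ′ ′
  open ClosedSet public

  closure : Subset X → ClosedSet
  closure A = mk (A ′ ′) (A⊆A″ (A ′ ′) , ′-anti (A⊆A″ (A ′)))

  infix  4 _≈_ _≤_ _⟂_
  infixr 7 _∧_
  infixr 6 _∨_
  infix  8 ∼_

  _≈_ _≤_ : Rel ClosedSet 0ℓ
  A ≈ C = set A ≐ set C
  A ≤ C = set A ⊆ set C

  ∼_ : ClosedSet → ClosedSet
  ∼ A = mk (set A ′) (A⊆A″ (set A ′) , ′-anti (A⊆A″ (set A)))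

  ⊥ ⊤ : ClosedSet
  ⊥ = mk ∅ ((λ ()) , λ {x} x∈∅″ → x∈∅″ x (λ _ ()) (inj₁ ε))
  ⊤ = mk U (A⊆A″ U , λ _ → tt)

  _∧_ : ClosedSet → ClosedSet → ClosedSet
  A ∧ C = mk (set A ∩ set C)
    ( A⊆A″ (set A ∩ set C)
    , λ x∈ → proj₂ (closed A) (′-anti (′-anti proj₁) x∈)
           , proj₂ (closed C) (′-anti (′-anti proj₂) x∈) )

  ⋁ : {I : Set} → (I → ClosedSet) → ClosedSet
  ⋁ {I} A = closure (⋃ I (set ∘ A))

  _∨_ : ClosedSet → ClosedSet → ClosedSet
  A ∨ C = closure (set A ∪ set C)

  _⟂_ : Rel ClosedSet 0ℓ
  A ⟂ C = A ≤ ∼ C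

  -- `resp`: families of closed sets must respect ≈, since closed sets are sets up
  -- to extensional equality.
  record BooleanSubalgebra : Set₁ where
    field
      Mem    : Subset ClosedSet
      resp   : Mem Respects _≈_
      ⊥∈     : Mem ⊥
      ⊤∈     : Mem ⊤
      ∼∈     : ∀ {A} → Mem A → Mem (∼ A)
      ∧∈     : ∀ {A C} → Mem A → Mem C → Mem (A ∧ C)
      ∨∈     : ∀ {A C} → Mem A → Mem C → Mem (A ∨ C)
      isBooleanAlgebra : IsBooleanAlgebra {A = ∃ Mem} (λ (A , _) (C , _) → A ≈ C)
        (λ (A , a) (C , c) → A ∨ C , ∨∈ a c)
        (λ (A , a) (C , c) → A ∧ C , ∧∈ a c)
        (λ (A , a) → ∼ A , ∼∈ a)
        (⊤ , ⊤∈) (⊥ , ⊥∈)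
  open BooleanSubalgebra public using (Mem)

  _≤ₛ_ : Rel BooleanSubalgebra (suc 0ℓ)
  S ≤ₛ T = Mem S ⊆ Mem T

  IsMaximal : Pred BooleanSubalgebra (suc 0ℓ)
  IsMaximal = Maximal _≤ₛ_ (λ _ → Unit)

  -- `IsAtom (Mem S)` is "atom of S"; `IsAtom U` is "atom of L(N)".
  IsAtom : Subset ClosedSet → Pred ClosedSet (suc 0ℓ)
  IsAtom S A = S A × ¬ (A ≈ ⊥) × (∀ C → S C → C ≤ A → C ≈ ⊥ ⊎ C ≈ A)

  AtomsAre : BooleanSubalgebra → {I : Set} → (I → ClosedSet) → Set₁
  AtomsAre S A = ∀ C → IsAtom (Mem S) C ⇔ (∃ λ i → C ≈ A i)

  β : (τ : Subset X) → ∃ τ → ClosedSet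
  β τ (b , _) = closure ｛ b ｝

  -- The subfamily of the non-empty members: an empty A i satisfies the
  -- orthogonality requirement but can never be an atom.
  NonEmpty : {I : Set} (A : I → ClosedSet) → (∃ λ i → ¬ (A i ≈ ⊥)) → ClosedSet
  NonEmpty A (i , _) = A i

  -- A Boolean subalgebra with atoms β need not be maximal in L(N): in the net
  -- b → e → {b₁ , b₂} the B-cut {b} has {b}″ = X, which forces the subalgebra
  -- {∅ , X}, properly contained in {∅ , {b₁} , {b₂} , X}.  Maximality
  -- is therefore relative to the subalgebras in which every A i is an atom.
  IsMaximalWithAtoms : {I : Set} → (I → ClosedSet) → Pred BooleanSubalgebra (suc 0ℓ)
  IsMaximalWithAtoms A = Maximal _≤ₛ_ (λ T → ∀ i → IsAtom (Mem T) (A i))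

{-# OPTIONS --safe #-}

-- Call C compatible with a family (A i) if every A i lies below C or below C′.
-- The compatible closed sets form the required subalgebra: once L(N) is known
-- to be orthomodular, a compatible C is the join of the A i below it, so the
-- order between compatible sets can be tested on the A i, and every lattice
-- law becomes a case distinction.
--
-- Orthomodularity is used in the form: if P ⟂ Q and (P ∪ Q)′ = ∅, then
-- P′ ⟂ Q′.  Let α and γ be maximal antichains of P and Q.  A path argument in
-- the causal net gives α′ ⊆ P′ and γ′ ⊆ Q′, so α ∪ γ is a cut.  If x ∈ P′ and
-- y ∈ Q′ were comparable, a line through both would meet the cut by
-- K-density, in a point of P comparable with x or a point of Q comparable
-- with y.
module Submission where

open import Defs
open import Algebra.Lattice.Structures using (IsBooleanAlgebra)
open import Algebra.Lattice.Structures.Biased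
  using (isBooleanAlgebraʳ; isDistributiveLatticeʳʲᵐ)
open import Data.Empty using (⊥-elim)
open import Data.Nat.Base using (ℕ; zero; suc; _*_; _≤′_; ≤′-refl; ≤′-step)
open import Data.Nat.Properties
  using (≤-total; ≤⇒≤′; even≢odd; *-cancelˡ-≡; suc-injective)
open import Data.Product using (∃; _×_; _,_; proj₁; proj₂)
open import Data.Sum.Base using (_⊎_; inj₁; inj₂; [_,_]; swap)
open import Function.Base using (_∘_; flip)
open import Function.Bundles using (Injection; mk⇔)
open import Function.Definitions using (Injective)
open import Level using (0ℓ)
open import Relation.Binary.Construct.Closure.ReflexiveTransitive
  using (Star; ε; _◅_; _◅◅_; reverse)
import Relation.Binary.Construct.On as On
open import Relation.Binary.Core using (Rel)
open import Relation.Binary.Definitions using (Reflexive; Symmetric)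
open import Relation.Binary.Lattice.Bundles using (DistributiveLattice)
import Relation.Binary.Lattice.Properties.DistributiveLattice as DistributiveLatticeₚ
import Relation.Binary.Lattice.Properties.Lattice as Latticeₚ
open import Relation.Binary.PropositionalEquality
  using (_≡_; _≢_; refl; sym; trans; cong; subst)
open import Relation.Nullary using (¬_; yes; no)
open import Relation.Unary using (_∈_; _⊆_; _∪_; U; ∅; ｛_｝)
open import Relation.Unary.Relation.Binary.Subset using (⊆-isPartialOrder)

-- On a countable type no choice is needed: the elements are offered to the
-- clique in the order of their codes.
module CliqueExtension {A : Set} (code : A → ℕ) (code-injective : Injective _≡_ _≡_ code)
  {R : Rel A 0ℓ} (R-refl : Reflexive R) (R-sym : Symmetric R)
  (P S₀ : Subset A) (S₀⊆P : S₀ ⊆ P)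
  (S₀-clique : ∀ x y → x ∈ S₀ → y ∈ S₀ → R x y)
  where

  stage : ℕ → Subset A
  stage zero    x = S₀ x
  stage (suc n) x = stage n x ⊎ (x ∈ P × code x ≡ n × (∀ y → y ∈ stage n → R x y))

  stage-clique : ∀ n x y → x ∈ stage n → y ∈ stage n → R x y
  stage-clique zero    x y x∈ y∈ = S₀-clique x y x∈ y∈
  stage-clique (suc n) x y (inj₁ x∈) (inj₁ y∈) = stage-clique n x y x∈ y∈
  stage-clique (suc n) x y (inj₁ x∈) (inj₂ (_ , _ , Ry)) = R-sym (Ry x x∈)
  stage-clique (suc n) x y (inj₂ (_ , _ , Rx)) (inj₁ y∈) = Rx y y∈
  -- Two elements added at the same stage carry the same code, so they are equal.
  stage-clique (suc n) x y (inj₂ (_ , p , _)) (inj₂ (_ , q , _))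
    with refl ← code-injective (trans p (sym q)) = R-refl

  stage-mono : ∀ {m n} → m ≤′ n → stage m ⊆ stage n
  stage-mono ≤′-refl       x∈ = x∈
  stage-mono (≤′-step m≤n) x∈ = inj₁ (stage-mono m≤n x∈)

  stage⊆P : ∀ n → stage n ⊆ P
  stage⊆P zero    x∈              = S₀⊆P x∈
  stage⊆P (suc n) (inj₁ x∈)       = stage⊆P n x∈
  stage⊆P (suc n) (inj₂ (x∈ , _)) = x∈

  clique : Subset A
  clique x = ∃ λ n → x ∈ stage n

  clique⊆P : clique ⊆ P
  clique⊆P (n , x∈) = stage⊆P n x∈

  S₀⊆clique : S₀ ⊆ clique
  S₀⊆clique x∈ = zero , x∈

  isClique : ∀ x y → x ∈ clique → y ∈ clique → R x y
  isClique x y (m , x∈) (n , y∈) with ≤-total m n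
  ... | inj₁ m≤n = stage-clique n x y (stage-mono (≤⇒≤′ m≤n) x∈) y∈
  ... | inj₂ n≤m = stage-clique m x y x∈ (stage-mono (≤⇒≤′ n≤m) y∈)

  clique-maximal : ∀ {x} → x ∈ P → (∀ y → y ∈ clique → R x y) → x ∈ clique
  clique-maximal {x} x∈P Rx =
    -- `x` is offered at the stage after its code and is related to everything collected before, all
    -- of which lies in `clique`.
    suc (code x) , inj₂ (x∈P , refl , λ y y∈ → Rx y (code x , y∈))

-- Stated for an arbitrary relation so that it applies both to F and to its converse.
module _ {B E : Set} {F : Rel (B ⊎ E) 0ℓ}
  (deterministic : ∀ {b y z} → F (inj₁ b) y → F (inj₁ b) z → y ≡ z)
  {P α : Subset (B ⊎ E)}
  (event-step : ∀ {e y} → inj₂ e ∈ P → F (inj₂ e) y → y ∈ P)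
  (convex : ∀ {x y z} → x ∈ P → Star F x y → Star F y z → z ∈ P → y ∈ P)
  (α⊆P : α ⊆ P)
  (α-meets : ∀ {p} → p ∈ P → ∃ λ a → a ∈ α × (Star F p a ⊎ Star F a p))
  where

  -- Induction on the path, keeping its starting point in `P`. From an event, `event-step` keeps the
  -- next point in `P`. From a condition, an element `a` of `α` at or below `p` is also below `x`;
  -- if `a` lies strictly above `p`, determinism makes the path to `a` share the next step, which
  -- convexity then keeps in `P`.
  path-meets : ∀ {p x} → p ∈ P → Star F p x →
               ∃ λ a → a ∈ α × (Star F x a ⊎ Star F a x)
  path-meets p∈P ε = α-meets p∈P
  path-meets {inj₂ e} p∈P (f ◅ q) = path-meets (event-step p∈P f) q
  path-meets {inj₁ b} p∈P (f ◅ q) with α-meets p∈P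
  ... | a , a∈α , inj₂ a⊑p = a , a∈α , inj₂ (a⊑p ◅◅ f ◅ q)
  ... | a , a∈α , inj₁ ε   = a , a∈α , inj₂ (f ◅ q)
  ... | a , a∈α , inj₁ (g ◅ r)
    with refl ← deterministic f g = path-meets (convex p∈P (f ◅ ε) r (α⊆P a∈α)) q

-- Order and concurrency in a causal net.

module Concurrency (em : Classical) (N : Net) (causal : NetTheory.IsCausal N) where

  open NetTheory N
  open IsCausal causal

  co-sym : ∀ {x y} → x co y → y co x
  co-sym = _∘ swap

  ⟂-sym : ∀ A C → A ⟂ C → C ⟂ A
  ⟂-sym A C A⟂C x∈C y y∈A = co-sym (A⟂C y∈A _ x∈C)

  closure-least : ∀ {A} C → A ⊆ set C → closure A ≤ C
  closure-least C A⊆C = proj₂ (closed C) ∘ ′-anti (′-anti A⊆C)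

  co-irrefl : ∀ {x} → ¬ (x co x)
  co-irrefl x-co-x = x-co-x (inj₁ ε)

  code : X → ℕ
  code (inj₁ b) = 2 * Injection.to countB b
  code (inj₂ e) = suc (2 * Injection.to countE e)

  code-injective : Injective _≡_ _≡_ code
  code-injective {inj₁ b} {inj₁ c} eq =
    cong inj₁ (Injection.injective countB (*-cancelˡ-≡ _ _ 2 eq))
  code-injective {inj₁ b} {inj₂ e} eq =
    ⊥-elim (even≢odd (Injection.to countB b) (Injection.to countE e) eq)
  code-injective {inj₂ e} {inj₁ b} eq =
    ⊥-elim (even≢odd (Injection.to countB b) (Injection.to countE e) (sym eq))
  code-injective {inj₂ e} {inj₂ d} eq =
    cong inj₂ (Injection.injective countE (*-cancelˡ-≡ _ _ 2 (suc-injective eq)))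

  event-successor : ∀ {e y} → F (inj₂ e) y → IsCondition y
  event-successor f with bipartite f
  ... | inj₁ ((_ , ()) , _)
  ... | inj₂ (_ , y-cond) = y-cond

  event-predecessor : ∀ {e y} → F y (inj₂ e) → IsCondition y
  event-predecessor f with bipartite f
  ... | inj₁ (y-cond , _) = y-cond
  ... | inj₂ (_ , (_ , ()))

  -- A condition has at most one predecessor, so a nontrivial path into it must pass through `e`.
  ⊑-before : ∀ {e b w} → F e (inj₁ b) → w ⊑ inj₁ b → w ≡ inj₁ b ⊎ w ⊑ e
  ⊑-before f ε = inj₁ refl
  ⊑-before f (g ◅ p) with ⊑-before f p
  ... | inj₁ refl with refl ← pre≤1 _ _ _ f g = inj₂ ε
  ... | inj₂ q    = inj₂ (g ◅ q)

  ⊑-after : ∀ {e b w} → F (inj₁ b) e → inj₁ b ⊑ w → w ≡ inj₁ b ⊎ e ⊑ w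
  ⊑-after f ε = inj₁ refl
  ⊑-after f (g ◅ p) with refl ← post≤1 _ _ _ f g = inj₂ p

  -- Read contrapositively: whatever is concurrent with `e` is concurrent with the adjacent
  -- condition `b`. With `li-post`, this puts the neighbours of an event into every closed set that
  -- contains it.
  li-pre : ∀ {e b w} → F e (inj₁ b) → inj₁ b li w → e li w
  li-pre f (inj₁ b⊑w) = inj₁ (f ◅ b⊑w)
  li-pre f (inj₂ w⊑b) with ⊑-before f w⊑b
  ... | inj₁ refl = inj₁ (f ◅ ε)
  ... | inj₂ w⊑e  = inj₂ w⊑e

  li-post : ∀ {e b w} → F (inj₁ b) e → inj₁ b li w → e li w
  li-post f (inj₂ w⊑b) = inj₂ (w⊑b ◅◅ f ◅ ε)
  li-post f (inj₁ b⊑w) with ⊑-after f b⊑w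
  ... | inj₁ refl = inj₂ (f ◅ ε)
  ... | inj₂ e⊑w  = inj₁ e⊑w

  -- Closed sets along paths.

  module _ (P : ClosedSet) where

    -- By transitivity, anything comparable with the middle point is comparable with one of the
    -- ends, so the middle point is concurrent with all of `set P ′`.
    convex : ∀ {x y z} → x ∈ set P → x ⊑ y → y ⊑ z → z ∈ set P → y ∈ set P
    convex x∈P x⊑y y⊑z z∈P = proj₂ (closed P) λ w w∈P′ →
      [ (λ y⊑w → w∈P′ _ x∈P (inj₂ (x⊑y ◅◅ y⊑w)))
      , (λ w⊑y → w∈P′ _ z∈P (inj₁ (w⊑y ◅◅ y⊑z))) ]

    event-post : ∀ {e y} → inj₂ e ∈ set P → F (inj₂ e) y → y ∈ set P
    event-post e∈P f with _ , refl ← event-successor f =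
      proj₂ (closed P) λ w w∈P′ y-li-w → w∈P′ _ e∈P (swap (li-pre f y-li-w))

    event-pre : ∀ {e y} → inj₂ e ∈ set P → F y (inj₂ e) → y ∈ set P
    event-pre e∈P f with _ , refl ← event-predecessor f =
      proj₂ (closed P) λ w w∈P′ y-li-w → w∈P′ _ e∈P (swap (li-post f y-li-w))

    module _ {α : Subset X} (α⊆P : α ⊆ set P)
      (α-meets : ∀ {p} → p ∈ set P → ∃ λ a → a ∈ α × p li a) where

      private
        unflip : ∀ {x y} → Star (flip F) x y → y ⊑ x
        unflip = reverse λ f → f

        to-flip : ∀ {x y} → x ⊑ y → Star (flip F) y x
        to-flip = reverse λ f → f

        li⇒flip : ∀ {x y} → x li y → Star (flip F) x y ⊎ Star (flip F) y x
        li⇒flip (inj₁ x⊑y) = inj₂ (to-flip x⊑y)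
        li⇒flip (inj₂ y⊑x) = inj₁ (to-flip y⊑x)

      comparable-meets : ∀ {p x} → p ∈ set P → x li p → ∃ λ a → a ∈ α × x li a
      comparable-meets p∈P (inj₂ p⊑x) =
        path-meets {F = F} (post≤1 _ _ _) event-post convex α⊆P α-meets p∈P p⊑x
      -- The same argument runs against the arrows: conditions have at most one predecessor, and
      -- `event-pre` replaces `event-post`.
      comparable-meets p∈P (inj₁ x⊑p)
        with a , a∈α , c ← path-meets {F = flip F} (pre≤1 _ _ _) event-pre
               (λ x∈P p q z∈P → convex z∈P (unflip q) (unflip p) x∈P)
               α⊆P (λ p∈P → let a , a∈α , c = α-meets p∈P in a , a∈α , li⇒flip c)
               p∈P (to-flip x⊑p)
        = a , a∈α , [ inj₂ ∘ unflip , inj₁ ∘ unflip ] c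

      ′-from-antichain : α ′ ⊆ set P ′
      ′-from-antichain x∈α′ p p∈P x-li-p
        with a , a∈α , x-li-a ← comparable-meets p∈P x-li-p = x∈α′ a a∈α x-li-a

  -- Antichains, cuts and lines.

  antichain-meets : ∀ {P α : Subset X} →
    (∀ {x} → x ∈ P → (∀ y → y ∈ α → x co y ⊎ x ≡ y) → x ∈ α) →
    ∀ {p} → p ∈ P → ∃ λ a → a ∈ α × p li a
  antichain-meets {α = α} maximal {p} p∈P with em {P = ∃ λ a → a ∈ α × p li a}
  ... | yes m = m
  ... | no ¬m = p , maximal p∈P (λ y y∈α → inj₁ λ c → ¬m (y , y∈α , c)) , inj₁ ε

  antichain⇒cut : ∀ {τ} → (∀ x y → x ∈ τ → y ∈ τ → x co y ⊎ x ≡ y) →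
                  τ ′ ⊆ ∅ → IsCut τ
  antichain⇒cut {τ} antichain τ′⊆∅ = antichain , maximal
    where
    maximal : ∀ σ → (∀ x y → x ∈ σ → y ∈ σ → x co y ⊎ x ≡ y) → τ ⊆ σ → σ ⊆ τ
    maximal σ σ-antichain τ⊆σ {x} x∈σ with em {P = x ∈ τ}
    ... | yes x∈τ = x∈τ
    ... | no  x∉τ = ⊥-elim (τ′⊆∅ {x} λ y y∈τ →
      [ (λ c → c) , (λ { refl → ⊥-elim (x∉τ y∈τ) }) ] (σ-antichain x y x∈σ (τ⊆σ y∈τ)))

  -- A point concurrent with all of `τ` could be added to it; by maximality it is already in `τ`,
  -- hence concurrent with itself.
  cut-′-empty : ∀ {τ} → IsCut τ → τ ′ ⊆ ∅
  cut-′-empty {τ} (antichain , maximal) {x} x∈τ′ =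
    co-irrefl (x∈τ′ x (maximal (τ ∪ ｛ x ｝) antichain′ inj₁ (inj₂ refl)))
    where
    antichain′ : ∀ y z → y ∈ τ ∪ ｛ x ｝ → z ∈ τ ∪ ｛ x ｝ → y co z ⊎ y ≡ z
    antichain′ y z (inj₁ y∈τ)  (inj₁ z∈τ)  = antichain y z y∈τ z∈τ
    antichain′ y z (inj₁ y∈τ)  (inj₂ refl) = inj₁ (co-sym (x∈τ′ y y∈τ))
    antichain′ y z (inj₂ refl) (inj₁ z∈τ)  = inj₁ (x∈τ′ z z∈τ)
    antichain′ y z (inj₂ refl) (inj₂ refl) = inj₂ refl

  line-through : ∀ {x y} → x li y → ∃ λ ℓ → IsLine ℓ × x ∈ ℓ × y ∈ ℓ
  line-through {x} {y} x-li-y =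
    clique , (isClique , λ σ σ-chain ℓ⊆σ z∈σ →
                clique-maximal _ (λ w w∈ → σ-chain _ w z∈σ (ℓ⊆σ w∈)))
    , S₀⊆clique (inj₁ refl) , S₀⊆clique (inj₂ refl)
    where
    pair-chain : ∀ z w → z ∈ ｛ x ｝ ∪ ｛ y ｝ → w ∈ ｛ x ｝ ∪ ｛ y ｝ → z li w
    pair-chain z w (inj₁ refl) (inj₁ refl) = inj₁ ε
    pair-chain z w (inj₁ refl) (inj₂ refl) = x-li-y
    pair-chain z w (inj₂ refl) (inj₁ refl) = swap x-li-y
    pair-chain z w (inj₂ refl) (inj₂ refl) = inj₁ ε
    open CliqueExtension code code-injective {R = _li_} (inj₁ ε) swap
      U (｛ x ｝ ∪ ｛ y ｝) _ pair-chain

  -- Orthomodularity from K-density.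

  co⊎≡-sym : Symmetric λ x y → x co y ⊎ x ≡ y
  co⊎≡-sym (inj₁ x-co-y) = inj₁ (co-sym x-co-y)
  co⊎≡-sym (inj₂ x≡y)    = inj₂ (sym x≡y)

  -- Maximal only among the antichains inside `P`; the seed is empty.
  module MaximalAntichain (P : Subset X) =
    CliqueExtension code code-injective {R = λ x y → x co y ⊎ x ≡ y}
      (inj₂ refl) co⊎≡-sym P ∅ (λ ()) (λ _ _ ())

  -- As `Q` is closed, `∼ P ⟂ ∼ Q` amounts to `∼ P ≤ Q`: orthogonal closed sets with no common
  -- concurrent point are complements of each other.
  orthomodular : IsKDense → (P Q : ClosedSet) → P ⟂ Q →
                 (set P ∪ set Q) ′ ⊆ ∅ → ∼ P ⟂ ∼ Q
  orthomodular kdense P Q P⟂Q total {x} x∈P′ y y∈Q′ x-li-y =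
    let ℓ , ℓ-line , x∈ℓ , y∈ℓ = line-through x-li-y
        t , t∈τ , t∈ℓ          = kdense τ ℓ τ-cut ℓ-line
    in [ (λ t∈α → x∈P′ t (α.clique⊆P t∈α) (proj₁ ℓ-line x t x∈ℓ t∈ℓ))
       , (λ t∈γ → y∈Q′ t (γ.clique⊆P t∈γ) (proj₁ ℓ-line y t y∈ℓ t∈ℓ)) ] t∈τ
    where
    module α = MaximalAntichain (set P)
    module γ = MaximalAntichain (set Q)

    τ : Subset X
    τ = α.clique ∪ γ.clique

    τ-antichain : ∀ x y → x ∈ τ → y ∈ τ → x co y ⊎ x ≡ y
    τ-antichain x y (inj₁ x∈) (inj₁ y∈) = α.isClique x y x∈ y∈
    τ-antichain x y (inj₁ x∈) (inj₂ y∈) = inj₁ (P⟂Q (α.clique⊆P x∈) y (γ.clique⊆P y∈))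
    τ-antichain x y (inj₂ x∈) (inj₁ y∈) =
      inj₁ (co-sym (P⟂Q (α.clique⊆P y∈) x (γ.clique⊆P x∈)))
    τ-antichain x y (inj₂ x∈) (inj₂ y∈) = γ.isClique x y x∈ y∈

    τ′⊆∅ : τ ′ ⊆ ∅
    -- A point concurrent with both antichains is concurrent with all of `P` and `Q`, against
    -- `total`.
    τ′⊆∅ {z} z∈τ′ = total {z} λ
      { p (inj₁ p∈P) → ′-from-antichain P α.clique⊆P (antichain-meets α.clique-maximal)
                         (λ a a∈ → z∈τ′ a (inj₁ a∈)) p p∈P
      ; q (inj₂ q∈Q) → ′-from-antichain Q γ.clique⊆P (antichain-meets γ.clique-maximal)
                         (λ a a∈ → z∈τ′ a (inj₂ a∈)) q q∈Q }

    τ-cut : IsCut τ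
    τ-cut = antichain⇒cut τ-antichain τ′⊆∅

  -- Each of `A ∧ C` and `A ∧ ∼ C` is a member of `T` below the atom, hence `⊥` or `A`. They are not
  -- both `⊥`, since distributivity in `T` makes `A` their join.
  atom-splits : ∀ T {A C} → IsAtom (Mem T) A → Mem T C → A ≤ C ⊎ A ⟂ C
  atom-splits T {A} {C} (A∈T , A≉⊥ , minimal) C∈T
    with minimal (A ∧ C) (T.∧∈ A∈T C∈T) proj₁
       | minimal (A ∧ ∼ C) (T.∧∈ A∈T (T.∼∈ C∈T)) proj₁
    where module T = BooleanSubalgebra T
  ... | inj₂ (_ , A≤A∧C) | _                 = inj₁ (proj₂ ∘ A≤A∧C)
  ... | inj₁ _           | inj₂ (_ , A≤A∧∼C) = inj₂ (proj₂ ∘ A≤A∧∼C)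
  ... | inj₁ (A∧C≤⊥ , _) | inj₁ (A∧∼C≤⊥ , _) = ⊥-elim (A≉⊥ (A≤⊥ , λ ()))
    where
    module T = BooleanSubalgebra T
    open IsBooleanAlgebra T.isBooleanAlgebra
    A≤⊥ : A ≤ ⊥
    A≤⊥ {x} x∈A = closure-least ⊥ [ A∧C≤⊥ , A∧∼C≤⊥ ]
      (proj₁ (∧-distribˡ-∨ (A , A∈T) (C , C∈T) (∼ C , T.∼∈ C∈T))
        (x∈A , proj₂ (∨-complementʳ (C , C∈T)) _))

  -- The subalgebra of compatible closed sets.

  module FamilySubalgebra (kdense : IsKDense) {I : Set} (A : I → ClosedSet)
    (comparable : ∀ i j → A i ≤ A j ⊎ A i ⟂ A j) (cover : ⋁ A ≈ ⊤) where

    Compatible : Subset ClosedSet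
    Compatible C = ∀ i → A i ≤ C ⊎ A i ⟂ C

    -- `P` joins the members below `C`, and `Q` those orthogonal to `C`. Since `P ≤ D` and
    -- `C ≤ ∼ Q`, orthomodularity makes `C` concurrent with `set D ′`, and `D` is closed.
    ≤-on-family : ∀ C D → Compatible C → (∀ i → A i ≤ C → A i ≤ D) → C ≤ D
    ≤-on-family C D C-comp h {x} x∈C = proj₂ (closed D) λ y y∈D′ →
      co-sym (orthomodular kdense P Q P⟂Q total
        (′-anti (closure-least D λ ((i , Ai≤C) , z∈) → h i Ai≤C z∈) y∈D′)
        x (⟂-sym Q C (closure-least (∼ C) λ ((i , Ai⟂C) , z∈) → Ai⟂C z∈) x∈C))
      where
      P Q : ClosedSet
      P = ⋁ {∃ λ i → A i ≤ C} (A ∘ proj₁)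
      Q = ⋁ {∃ λ i → A i ⟂ C} (A ∘ proj₁)

      P⟂Q : P ⟂ Q
      P⟂Q x∈P y y∈Q = co-sym
        (closure-least (∼ C) (λ ((i , Ai⟂C) , z∈) → Ai⟂C z∈) y∈Q _
          (closure-least C (λ ((i , Ai≤C) , z∈) → Ai≤C z∈) x∈P))

      total : (set P ∪ set Q) ′ ⊆ ∅
      -- `x` is concurrent with every member, while `cover` puts it in the double complement of
      -- their union, so it is concurrent with itself.
      total {x} x∈ = co-irrefl (proj₂ cover {x} _ x λ
        { y (i , y∈Ai) → [ (λ Ai≤C → x∈ y (inj₁ (A⊆A″ _ ((i , Ai≤C) , y∈Ai))))
                         , (λ Ai⟂C → x∈ y (inj₂ (A⊆A″ _ ((i , Ai⟂C) , y∈Ai)))) ]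
                         (C-comp i) })

    compatible-resp : ∀ {C D} → C ≈ D → Compatible C → Compatible D
    compatible-resp (C≤D , D≤C) C-comp i with C-comp i
    ... | inj₁ Ai≤C = inj₁ (C≤D ∘ Ai≤C)
    ... | inj₂ Ai⟂C = inj₂ (′-anti D≤C ∘ Ai⟂C)

    ∼-compatible : ∀ {C} → Compatible C → Compatible (∼ C)
    ∼-compatible {C} C-comp i with C-comp i
    ... | inj₁ Ai≤C = inj₂ (A⊆A″ (set C) ∘ Ai≤C)
    ... | inj₂ Ai⟂C = inj₁ Ai⟂C

    ∧-compatible : ∀ {C D} → Compatible C → Compatible D → Compatible (C ∧ D)
    ∧-compatible C-comp D-comp i with C-comp i | D-comp i
    ... | inj₁ Ai≤C | inj₁ Ai≤D = inj₁ λ x∈ → Ai≤C x∈ , Ai≤D x∈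
    ... | inj₂ Ai⟂C | _         = inj₂ (′-anti proj₁ ∘ Ai⟂C)
    ... | _         | inj₂ Ai⟂D = inj₂ (′-anti proj₂ ∘ Ai⟂D)

    ⟂-∨ : ∀ {C D} i → A i ⟂ C → A i ⟂ D → A i ⟂ (C ∨ D)
    ⟂-∨ i Ai⟂C Ai⟂D x∈ = A⊆A″ _ λ y → [ Ai⟂C x∈ y , Ai⟂D x∈ y ]

    ∨-compatible : ∀ {C D} → Compatible C → Compatible D → Compatible (C ∨ D)
    ∨-compatible {C} {D} C-comp D-comp i with C-comp i | D-comp i
    ... | inj₁ Ai≤C | _         = inj₁ (A⊆A″ _ ∘ inj₁ ∘ Ai≤C)
    ... | _         | inj₁ Ai≤D = inj₁ (A⊆A″ _ ∘ inj₂ ∘ Ai≤D)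
    ... | inj₂ Ai⟂C | inj₂ Ai⟂D = inj₂ (⟂-∨ {C} {D} i Ai⟂C Ai⟂D)

    ∧-∨-distrib : ∀ {C D G} → Compatible C → Compatible D → Compatible G →
                  C ∧ (D ∨ G) ≤ (C ∧ D) ∨ (C ∧ G)
    ∧-∨-distrib {C} {D} {G} C-comp D-comp G-comp =
      ≤-on-family (C ∧ (D ∨ G)) ((C ∧ D) ∨ (C ∧ G))
        (∧-compatible {C} {D ∨ G} C-comp (∨-compatible {D} {G} D-comp G-comp)) on-family
      where
      on-family : ∀ i → A i ≤ C ∧ (D ∨ G) → A i ≤ (C ∧ D) ∨ (C ∧ G)
      on-family i h with D-comp i | G-comp i
      ... | inj₁ Ai≤D | _         = λ x∈ → A⊆A″ _ (inj₁ (proj₁ (h x∈) , Ai≤D x∈))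
      ... | _         | inj₁ Ai≤G = λ x∈ → A⊆A″ _ (inj₂ (proj₁ (h x∈) , Ai≤G x∈))
      -- Such a member is both below `D ∨ G` and orthogonal to it, so it is empty.
      ... | inj₂ Ai⟂D | inj₂ Ai⟂G = λ x∈ →
        ⊥-elim (co-irrefl (⟂-∨ {D} {G} i Ai⟂D Ai⟂G x∈ _ (proj₂ (h x∈))))

    ∨-∼-top : ∀ C → ⊤ ≤ C ∨ ∼ C
    ∨-∼-top C {x} _ y y∈ =
      ⊥-elim (co-irrefl (y∈ y (inj₂ λ z z∈C → y∈ z (inj₁ z∈C))))

    distributiveLattice : DistributiveLattice _ _ _
    distributiveLattice = record
      { Carrier = ∃ Compatible
      ; _≈_ = λ (C , _) (D , _) → C ≈ D
      ; _≤_ = λ (C , _) (D , _) → C ≤ D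
      ; _∨_ = λ (C , c) (D , d) → C ∨ D , ∨-compatible {C} {D} c d
      ; _∧_ = λ (C , c) (D , d) → C ∧ D , ∧-compatible {C} {D} c d
      ; isDistributiveLattice = record
        { isLattice = record
          { isPartialOrder = On.isPartialOrder (set ∘ proj₁) ⊆-isPartialOrder
          ; supremum = λ (C , _) (D , _) →
              A⊆A″ _ ∘ inj₁ , A⊆A″ _ ∘ inj₂
            , λ (G , _) C≤G D≤G → closure-least G [ C≤G , D≤G ]
          ; infimum = λ _ _ → proj₁ , proj₂ , λ _ G≤C G≤D x∈ → G≤C x∈ , G≤D x∈
          }
        ; ∧-distribˡ-∨ = λ (C , c) (D , d) (G , g) →
            ∧-∨-distrib {C} {D} {G} c d g
          , closure-least (C ∧ (D ∨ G))
              [ (λ (x∈C , x∈D) → x∈C , A⊆A″ _ (inj₁ x∈D))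
              , (λ (x∈C , x∈G) → x∈C , A⊆A″ _ (inj₂ x∈G)) ]
        }
      }

    S : BooleanSubalgebra
    S = record
      { Mem  = Compatible
      ; resp = λ {C} {D} → compatible-resp {C} {D}
      ; ⊥∈   = λ i → inj₂ λ _ _ ()
      ; ⊤∈   = λ i → inj₁ _
      ; ∼∈   = λ {C} → ∼-compatible {C}
      ; ∧∈   = λ {C} {D} → ∧-compatible {C} {D}
      ; ∨∈   = λ {C} {D} → ∨-compatible {C} {D}
      ; isBooleanAlgebra = isBooleanAlgebraʳ record
        { isDistributiveLattice = isDistributiveLatticeʳʲᵐ record
          { isLattice = Latticeₚ.isAlgLattice
              (DistributiveLattice.lattice distributiveLattice)
          ; ∨-distribʳ-∧ = DistributiveLatticeₚ.∨-distribʳ-∧ distributiveLattice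
          }
        ; ∨-complementʳ = λ (C , _) → _ , ∨-∼-top C
        ; ∧-complementʳ = λ (C , _) →
            (λ (x∈C , x∈C′) → co-irrefl (x∈C′ _ x∈C)) , λ ()
        ; ¬-cong = λ (C≤D , D≤C) → ′-anti D≤C , ′-anti C≤D
        }
      }

    member-isAtom : ∀ i → ¬ (A i ≈ ⊥) → IsAtom (Mem S) (A i)
    -- With its arguments flipped, `comparable` says that each member is itself compatible.
    member-isAtom i Ai≉⊥ = flip comparable i , Ai≉⊥ , minimal
      where
      minimal : ∀ C → Compatible C → C ≤ A i → C ≈ ⊥ ⊎ C ≈ A i
      minimal C C-comp C≤Ai with C-comp i
      ... | inj₁ Ai≤C = inj₂ (C≤Ai , Ai≤C)
      ... | inj₂ Ai⟂C = inj₁ ((λ x∈C → co-irrefl (Ai⟂C (C≤Ai x∈C) _ x∈C)) , λ ())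

    isAtom-resp : ∀ {C D} → C ≈ D → IsAtom (Mem S) D → IsAtom (Mem S) C
    isAtom-resp {C} {D} (C≤D , D≤C) (D-comp , D≉⊥ , D-minimal) =
      compatible-resp {D} {C} (D≤C , C≤D) D-comp , (λ (C≤⊥ , _) → D≉⊥ (C≤⊥ ∘ D≤C , λ ())) , minimal
      where
      minimal : ∀ G → Compatible G → G ≤ C → G ≈ ⊥ ⊎ G ≈ C
      minimal G G-comp G≤C with D-minimal G G-comp (C≤D ∘ G≤C)
      ... | inj₁ G≈⊥         = inj₁ G≈⊥
      ... | inj₂ (G≤D , D≤G) = inj₂ (D≤C ∘ G≤D , D≤G ∘ C≤D)

    -- A compatible set with no non-empty member below it is empty, by `≤-on-family` with `⊥`;
    -- otherwise minimality identifies the atom with such a member.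
    atom⇒member : ∀ C → IsAtom (Mem S) C → ∃ λ i → ¬ (A i ≈ ⊥) × C ≈ A i
    atom⇒member C (C-comp , C≉⊥ , minimal)
      with em {P = ∃ λ i → ¬ (A i ≈ ⊥) × A i ≤ C}
    ... | no ¬∃ = ⊥-elim (C≉⊥ (≤-on-family C ⊥ C-comp all-empty , λ ()))
      where
      all-empty : ∀ i → A i ≤ C → A i ≤ ⊥
      all-empty i Ai≤C {x} x∈ = ⊥-elim (¬∃ (i , (λ (Ai≤⊥ , _) → Ai≤⊥ x∈) , Ai≤C))
    ... | yes (i , Ai≉⊥ , Ai≤C) with minimal (A i) (flip comparable i) Ai≤C
    ...   | inj₁ Ai≈⊥       = ⊥-elim (Ai≉⊥ Ai≈⊥)
    ...   | inj₂ (_ , C≤Ai) = i , Ai≉⊥ , C≤Ai , Ai≤C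

    -- Membership in `S` is exactly the dichotomy of `atom-splits`; maximality follows from this.
    contains-subalgebras : ∀ T → (∀ i → IsAtom (Mem T) (A i)) → T ≤ₛ S
    contains-subalgebras T atoms C∈T i = atom-splits T (atoms i) C∈T

  -- Closures of the points of a cut.

  module BCut {τ : Subset X} (τ-cut : IsCut τ) where

    β-nonempty : ∀ i → ¬ (β τ i ≈ ⊥)
    β-nonempty (b , _) (β≤⊥ , _) = β≤⊥ (A⊆A″ ｛ b ｝ refl)

    β-orthogonal : ∀ i j → proj₁ i ≢ proj₁ j → β τ i ⟂ β τ j
    β-orthogonal (b , b∈τ) (c , c∈τ) b≢c =
      closure-least (∼ closure ｛ c ｝) λ { refl → A⊆A″ _ λ { _ refl →
        [ (λ co → co) , (λ b≡c → ⊥-elim (b≢c b≡c)) ] (proj₁ τ-cut b c b∈τ c∈τ) } }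

    β-comparable : ∀ i j → β τ i ≤ β τ j ⊎ β τ i ⟂ β τ j
    -- An index carries a membership proof, so distinct indices may name the same point; the case
    -- split is on points.
    β-comparable i j with em {P = proj₁ i ≡ proj₁ j}
    ... | yes b≡c = inj₁ (subst (λ b → closure ｛ proj₁ i ｝ ≤ closure ｛ b ｝) b≡c λ x∈ → x∈)
    ... | no  b≢c = inj₂ (β-orthogonal i j b≢c)

    -- A point concurrent with every `β τ i` would be concurrent with the whole cut, so there is
    -- none.
    β-cover : ⋁ (β τ) ≈ ⊤
    β-cover = _ , λ {x} _ y y∈ → ⊥-elim (cut-′-empty τ-cut {y} λ b b∈τ →
      y∈ b ((b , b∈τ) , A⊆A″ ｛ b ｝ refl))

mainTheorem2 : Classical → (N : Net) →
    let open NetTheory N in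
    IsCausal → IsLocallyFinite → IsKDense →
    ((τ : Subset X) → IsBCut τ →
    (∀ i j → proj₁ i ≢ proj₁ j → β τ i ⟂ β τ j)
    × ⋁ (β τ) ≈ ⊤
    × (∃ λ S → AtomsAre S (β τ)
    × IsMaximalWithAtoms (β τ) S
    × ((∀ i → IsAtom U (β τ i)) → IsMaximal S)))
    × ((I : Set) (A : I → ClosedSet) →
    (∀ i j → i ≢ j → A i ⟂ A j) → ⋁ A ≈ ⊤ →
    ∃ λ S → AtomsAre S (NonEmpty A))
mainTheorem2 em N causal _ kdense = partA , partB
  where
  open NetTheory N
  open Concurrency em N causal

  partA : (τ : Subset X) → IsBCut τ →
    (∀ i j → proj₁ i ≢ proj₁ j → β τ i ⟂ β τ j)
    × ⋁ (β τ) ≈ ⊤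
    × (∃ λ S → AtomsAre S (β τ)
    × IsMaximalWithAtoms (β τ) S
    × ((∀ i → IsAtom U (β τ i)) → IsMaximal S))
  partA τ (τ-cut , _) = β-orthogonal , β-cover , S
    , (λ C → mk⇔ (λ atom → let i , _ , C≈βi = atom⇒member C atom in i , C≈βi)
                 (λ (i , C≈βi) → isAtom-resp {C} {β τ i} C≈βi (β-isAtom i)))
    , (β-isAtom , λ T atoms _ {C} → contains-subalgebras T atoms {C})
    -- Atoms of the whole lattice remain atoms in every subalgebra `T` above `S`, so `T` falls under
    -- `contains-subalgebras`.
    , λ atoms → _ , λ T _ S≤T {C} → contains-subalgebras T
        (λ i → let _ , βi≉⊥ , minimal = atoms i in
               S≤T {β τ i} (proj₁ (β-isAtom i)) , βi≉⊥ , λ D _ → minimal D _) {C}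
    where
    open BCut τ-cut
    open FamilySubalgebra kdense (β τ) β-comparable β-cover

    β-isAtom : ∀ i → IsAtom (Mem S) (β τ i)
    β-isAtom i = member-isAtom i (β-nonempty i)

  partB : (I : Set) (A : I → ClosedSet) →
    (∀ i j → i ≢ j → A i ⟂ A j) → ⋁ A ≈ ⊤ →
    ∃ λ S → AtomsAre S (NonEmpty A)
  partB I A orthogonal cover = S
    , λ C → mk⇔ (λ atom → let i , Ai≉⊥ , C≈Ai = atom⇒member C atom in (i , Ai≉⊥) , C≈Ai)
                (λ ((i , Ai≉⊥) , C≈Ai) → isAtom-resp {C} {A i} C≈Ai (member-isAtom i Ai≉⊥))
    where
    comparable : ∀ i j → A i ≤ A j ⊎ A i ⟂ A j
    comparable i j with em {P = i ≡ j}
    ... | yes refl = inj₁ λ x∈ → x∈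
    ... | no  i≢j  = inj₂ (orthogonal i j i≢j)

    open FamilySubalgebra kdense A comparable cover
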